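{- $\mathrm{Parity}$ reduces to $\mathrm{BGGM}$ in $\mathrm{AC}^0$.
   Context: $\mathrm{Parity}=\{x\in\{0,1\}^*: \text{the number of 1's in } x \text{ is odd}\}$. A grid layered planar graph is a planar graph embedded in the integer lattice such that every edge joins lattice points $(a,b),(c,d)$ with $|a-c|\le1$; its length and width are its numbers of columns and rows. $\mathrm{BGGM}$ is the language of (encodings of) bipartite grid layered planar graphs, given together with their lattice embedding (i.e., which lattice points are vertices and which pairs of points are edges), that have a perfect matching. $\mathrm{AC}^0$ is the class of languages decided by (non-uniform) families of constant-depth, polynomial-size circuits with unbounded fan-in AND, OR and NOT gates; an $\mathrm{AC}^0$ reduction from $L$ to $L'$ is such a circuit family which may additionally use oracle gates for $L'$ and decides $L$. -}

module Defs where

open import Data.Bool using (Bool; true; false; not)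
open import Data.Bool.ListAction using (all; any)
open import Data.Nat using (ℕ; zero; suc; _+_; _*_; _^_; _≤_; _⊔_; ∣_-_∣)
open import Data.Fin using (Fin; toℕ)
open import Data.List as List using (List; []; _∷_; _++_; replicate; map; concatMap; allFin; cartesianProduct; foldr)
open import Data.Vec as Vec using (Vec; lookup; _∷ʳ_; last; toList)
open import Data.Integer using (+_)
open import Data.Rational as ℚ using (ℚ; 0ℚ; 1ℚ)
open import Data.Product using (Σ; ∃; ∃-syntax; _×_; _,_)
open import Data.Sum using (_⊎_)
open import Relation.Binary.PropositionalEquality using (_≡_; _≢_)
open import Relation.Nullary using (¬_)
open import Function.Bundles using (_⇔_)

-- Languages over {0,1}: true = 1, false = 0

Language : Set₁
Language = List Bool → Set

ones : List Bool → ℕ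
ones []           = 0
ones (true  ∷ xs) = suc (ones xs)
ones (false ∷ xs) = ones xs

Parity : Language
Parity x = ∃[ k ] ones x ≡ suc (2 * k)

-- A circuit on n inputs is a straight-line sequence of gates; the
-- gate number k may only refer to input bits and to gates 0..k-1.

data Gate (n k : ℕ) : Set where
  input  : Fin n → Gate n k
  and    : List (Fin k) → Gate n k
  or     : List (Fin k) → Gate n k
  neg    : Fin k → Gate n k
  oracle : List (Fin k) → Gate n k

data Circ (n : ℕ) : ℕ → Set where
  []  : Circ n 0
  _▷_ : ∀ {k} → Circ n k → Gate n k → Circ n (suc k)

gateVal : ∀ {n k} → (List Bool → Bool) → Vec Bool n → Vec Bool k → Gate n k → Bool
gateVal O x vs (input i)  = lookup x i
gateVal O x vs (and l)    = all (lookup vs) l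
gateVal O x vs (or l)     = any (lookup vs) l
gateVal O x vs (neg j)    = not (lookup vs j)
gateVal O x vs (oracle l) = O (map (lookup vs) l)

values : ∀ {n k} → (List Bool → Bool) → Circ n k → Vec Bool n → Vec Bool k
values O []      x = Vec.[]
values O (C ▷ g) x = let vs = values O C x in vs ∷ʳ gateVal O x vs g

gateDepth : ∀ {n k} → Vec ℕ k → Gate n k → ℕ
gateDepth ds (input i)  = 0
gateDepth ds (and l)    = suc (foldr _⊔_ 0 (map (lookup ds) l))
gateDepth ds (or l)     = suc (foldr _⊔_ 0 (map (lookup ds) l))
gateDepth ds (neg j)    = suc (lookup ds j)
gateDepth ds (oracle l) = suc (foldr _⊔_ 0 (map (lookup ds) l))

depths : ∀ {n k} → Circ n k → Vec ℕ k
depths []      = Vec.[]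
depths (C ▷ g) = let ds = depths C in ds ∷ʳ gateDepth ds g

-- A circuit with an output: a nonempty gate sequence whose last gate
-- is the output gate.  Its size is its number of gates.
record Circuit (n : ℕ) : Set where
  constructor circuit
  field
    size-1 : ℕ
    gates  : Circ n (suc size-1)

size : ∀ {n} → Circuit n → ℕ
size (circuit k _) = suc k

depth : ∀ {n} → Circuit n → ℕ
depth (circuit k C) = last (depths C)

output : ∀ {n} → (List Bool → Bool) → Circuit n → Vec Bool n → Bool
output O (circuit k C) x = last (values O C x)

Decides : (List Bool → Bool) → Language → Set
Decides O L = ∀ w → (O w ≡ true) ⇔ L w

-- L reduces to L' in (non-uniform) AC0: there is a family of circuits
-- (C n) with oracle gates for L', of size polynomial in n and constant
-- depth, such that C n decides L on inputs of length n.
_≤AC⁰_ : Language → Language → Set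
L ≤AC⁰ L' =
  Σ ((n : ℕ) → Circuit n) λ C →
  Σ ℕ λ c → Σ ℕ λ d →
    (∀ n → size (C n) ≤ c * n ^ c + c) ×
    (∀ n → depth (C n) ≤ d) ×
    (∀ (O : List Bool → Bool) → Decides O L' →
       ∀ n (x : Vec Bool n) → (output O (C n) x ≡ true) ⇔ L (toList x))

-- Graphs on lattice points, with their embedding.
-- Lattice point (a , b): a = column (0 ≤ a < len), b = row (0 ≤ b < wid).

Point : ℕ → ℕ → Set
Point L W = Fin L × Fin W

record LatticeGraph : Set where
  field
    len  : ℕ
    wid  : ℕ
    vert : Point len wid → Bool
    edge : Point len wid → Point len wid → Bool

points : (L W : ℕ) → List (Point L W)
points L W = cartesianProduct (allFin L) (allFin W)

-- Encoding: 1^len 0 1^wid 0, then the vertex bits of all lattice points,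
-- then the edge bits of all ordered pairs of lattice points
-- (points listed column by column).
encode : LatticeGraph → List Bool
encode G =
  replicate len true ++ false ∷ replicate wid true ++ false ∷
  map vert (points len wid) ++
  concatMap (λ p → map (edge p) (points len wid)) (points len wid)
  where open LatticeGraph G

ℚ² : Set
ℚ² = ℚ × ℚ

pos : ∀ {L W} → Point L W → ℚ²
pos (a , b) = ((+ toℕ a) ℚ./ 1 , (+ toℕ b) ℚ./ 1)

OnSegment : ℚ² → ℚ² → ℚ² → Set
OnSegment (x , y) (px , py) (qx , qy) =
  Σ ℚ λ s → (0ℚ ℚ.≤ s) × (s ℚ.≤ 1ℚ) ×
    (x ≡ px ℚ.+ s ℚ.* (qx ℚ.- px)) × (y ≡ py ℚ.+ s ℚ.* (qy ℚ.- py))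

module _ (G : LatticeGraph) where
  open LatticeGraph G

  private P = Point len wid

  WellFormed : Set
  WellFormed = ∀ (p q : P) → edge p q ≡ true →
    (vert p ≡ true) × (vert q ≡ true) × (p ≢ q) × (edge q p ≡ true) ×
    (∣ toℕ (Data.Product.proj₁ p) - toℕ (Data.Product.proj₁ q) ∣ ≤ 1)

  PlanarEmbedding : Set
  PlanarEmbedding =
    (∀ (v p q : P) → vert v ≡ true → edge p q ≡ true → v ≢ p → v ≢ q →
       ¬ OnSegment (pos v) (pos p) (pos q)) ×
    (∀ (p q p' q' : P) → edge p q ≡ true → edge p' q' ≡ true →
       ∀ (X : ℚ²) → OnSegment X (pos p) (pos q) → OnSegment X (pos p') (pos q') →
         ((p ≡ p' × q ≡ q') ⊎ (p ≡ q' × q ≡ p')) ⊎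
         (Σ P λ r → (r ≡ p ⊎ r ≡ q) × (r ≡ p' ⊎ r ≡ q') × (X ≡ pos r)))

  GridLayeredPlanar : Set
  GridLayeredPlanar = WellFormed × PlanarEmbedding

  Bipartite : Set
  Bipartite = Σ (P → Bool) λ colour →
    ∀ (p q : P) → edge p q ≡ true → colour p ≢ colour q

  HasPerfectMatching : Set
  HasPerfectMatching = Σ (P → P → Bool) λ M →
    (∀ p q → M p q ≡ true → edge p q ≡ true) ×
    (∀ p q → M p q ≡ true → M q p ≡ true) ×
    (∀ p → vert p ≡ true →
       Σ P λ q → (M p q ≡ true) × (∀ q' → M p q' ≡ true → q' ≡ q))

BGGM : Language
BGGM w = Σ LatticeGraph λ G →
  (encode G ≡ w) × GridLayeredPlanar G × Bipartite G × HasPerfectMatching G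

-- The reduction maps an input x of length n to its parity graph, a graph
-- drawn in a single column of 2n+1 rows: rows 0, 2, …, 2n are always
-- vertices, row 2j+1 is a vertex exactly when x_j = 0, and edges join
-- consecutive vertex rows.  This graph is a path on 2n+1 − #1(x) vertices,
-- so it has a perfect matching exactly when #1(x) is odd; being drawn in
-- one column it is bipartite, grid layered and planar.  Every bit of its
-- encoding is a constant, an input bit or a negated input bit, so the
-- reduction is computed by one oracle gate over the literals.
module Submission where

open import Defs
open import Data.Bool using (Bool; true; false; not; _∧_)
open import Data.Bool.Properties using (not-¬)
open import Data.Nat using (ℕ; zero; suc; _+_; _*_; _^_; _⊔_; _≤_; _<_; _≟_; _≤?_; _<?_; z≤n; s≤s)
open import Data.Nat.Properties
open import Data.Nat.Coprimality using (1-coprimeTo)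
import Data.Nat.Coprimality as Coprime
import Data.Integer as ℤ
import Data.Integer.Properties as ℤP
open import Data.Rational as ℚ using (ℚ; mkℚ; 0ℚ; 1ℚ)
import Data.Rational.Properties as ℚP
open import Data.Fin using (Fin; toℕ; fromℕ<)
open import Data.Fin.Properties using (toℕ-injective; toℕ-fromℕ<; toℕ<n)
open import Data.Product using (Σ; ∃-syntax; _×_; _,_; proj₁; proj₂)
open import Data.Sum using (_⊎_; inj₁; inj₂; swap)
open import Data.Empty using (⊥-elim)
open import Data.List as List using (List; []; _∷_; _++_; length; map; replicate; concatMap)
open import Data.List.Properties
  using (∷-injective; length-map; map-cong; map-∘; map-++; map-replicate; map-concatMap; concatMap-cong)
open import Data.List.Membership.Propositional using (_∈_)
open import Data.List.Membership.Propositional.Properties using (∈-cartesianProduct⁺; ∈-allFin)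
open import Data.List.Relation.Unary.Any using (here; there)
open import Data.Vec as Vec using (Vec; _∷ʳ_; lookup; toList)
open import Data.Vec.Properties using (last-∷ʳ; length-toList)
open import Relation.Nullary using (¬_; Dec; yes; no; does)
open import Relation.Nullary.Decidable using (dec-true)
open import Relation.Binary.Definitions using (tri<; tri≈; tri>)
open import Relation.Binary.PropositionalEquality
open import Function using (_∘_)
open import Function.Bundles using (_⇔_; mk⇔; Equivalence)
open import Function.Construct.Composition using (_⇔-∘_)

Even Odd : ℕ → Set
Even n = ∃[ k ] n ≡ 2 * k
Odd  n = ∃[ k ] n ≡ suc (2 * k)

even-or-odd : ∀ n → Even n ⊎ Odd n
even-or-odd zero = inj₁ (0 , refl)
even-or-odd (suc n) with even-or-odd n
... | inj₁ (k , refl) = inj₂ (k , refl)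
... | inj₂ (k , refl) = inj₁ (suc k , sym (*-suc 2 k))

odd+odd : ∀ k m → suc (2 * k) + suc (2 * m) ≡ 2 * suc (k + m)
odd+odd k m = begin
  suc (2 * k) + suc (2 * m)   ≡⟨ cong suc (+-suc (2 * k) (2 * m)) ⟩
  2 + (2 * k + 2 * m)         ≡⟨ cong (2 +_) (*-distribˡ-+ 2 k m) ⟨
  2 + 2 * (k + m)             ≡⟨ *-suc 2 (k + m) ⟨
  2 * suc (k + m)             ∎
  where open ≡-Reasoning

even⇔odd-complement : ∀ t o n → t + o ≡ suc (2 * n) → Even t ⇔ Odd o
even⇔odd-complement t o n sum = mk⇔ to from
  where
  to : Even t → Odd o
  to (k , refl) with even-or-odd o
  ... | inj₂ odd = odd
  ... | inj₁ (m , refl) = ⊥-elim (even≢odd (k + m) n (trans (*-distribˡ-+ 2 k m) sum))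
  from : Odd o → Even t
  from (m , refl) with even-or-odd t
  ... | inj₁ even = even
  ... | inj₂ (k , refl) = ⊥-elim (even≢odd (suc (k + m)) n (trans (sym (odd+odd k m)) sum))

isOdd : ℕ → Bool
isOdd zero    = false
isOdd (suc n) = not (isOdd n)

Step : ℕ → ℕ → Set
Step i j = j ≡ suc i ⊎ i ≡ suc j

step-flips-parity : ∀ {i j} → Step i j → isOdd i ≢ isOdd j
step-flips-parity (inj₁ refl) = not-¬ refl
step-flips-parity (inj₂ refl) = not-¬ refl ∘ sym

record Consecutive (v : ℕ → Bool) (a c : ℕ) : Set where
  field
    lower<upper : a < c
    lower       : v a ≡ true
    upper       : v c ≡ true
    gap         : ∀ m → a < m → m < c → v m ≡ false

Adjacent : (ℕ → Bool) → ℕ → ℕ → Set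
Adjacent v a c = Consecutive v a c ⊎ Consecutive v c a

bit : Bool → ℕ
bit true  = 1
bit false = 0

rank : (ℕ → Bool) → ℕ → ℕ
rank v zero    = 0
rank v (suc r) = bit (v r) + rank v r

module RankProperties (v : ℕ → Bool) where

  rank-past-vertex : ∀ {r} → v r ≡ true → rank v (suc r) ≡ suc (rank v r)
  rank-past-vertex {r} vr = cong (λ b → bit b + rank v r) vr

  rank-past-gap : ∀ {r} → v r ≡ false → rank v (suc r) ≡ rank v r
  rank-past-gap {r} vr = cong (λ b → bit b + rank v r) vr

  rank-mono : ∀ {a b} → a ≤ b → rank v a ≤ rank v b
  rank-mono {b = zero} z≤n = ≤-refl
  rank-mono {b = suc b} a≤b with m≤n⇒m<n∨m≡n a≤b
  ... | inj₂ refl     = ≤-refl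
  ... | inj₁ (s≤s a≤b') = ≤-trans (rank-mono a≤b') (m≤n+m (rank v b) (bit (v b)))

  rank-strict : ∀ {a b} → a < b → v a ≡ true → suc (rank v a) ≤ rank v b
  rank-strict {a} {b} a<b va = subst (_≤ rank v b) (rank-past-vertex va) (rank-mono a<b)

  rank-across-gap : ∀ {a} c → a < c → v a ≡ true → (∀ m → a < m → m < c → v m ≡ false) →
                    rank v c ≡ suc (rank v a)
  rank-across-gap {a} (suc c) (s≤s a≤c) va gap with m≤n⇒m<n∨m≡n a≤c
  ... | inj₂ refl = rank-past-vertex va
  ... | inj₁ a<c  = trans (rank-past-gap (gap c a<c ≤-refl))
                          (rank-across-gap c a<c va (λ m a<m m<c → gap m a<m (m≤n⇒m≤1+n m<c)))

  consecutive⇒rank-step : ∀ {a c} → Consecutive v a c → rank v c ≡ suc (rank v a)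
  consecutive⇒rank-step {c = c} cons = rank-across-gap c lower<upper lower gap
    where open Consecutive cons

  rank-onto : ∀ R k → k < rank v R → Σ ℕ λ r → r < R × v r ≡ true × rank v r ≡ k
  rank-onto (suc R) k k< with v R in vR
  ... | false with rank-onto R k k<
  ...   | r , r<R , vr , rk = r , m≤n⇒m≤1+n r<R , vr , rk
  rank-onto (suc R) k (s≤s k≤) | true with m≤n⇒m<n∨m≡n k≤
  ...   | inj₂ refl = R , ≤-refl , vR , refl
  ...   | inj₁ k<rank with rank-onto R k k<rank
  ...     | r , r<R , vr , rk = r , m≤n⇒m≤1+n r<R , vr , rk

  rank-injective : ∀ {a b} → v a ≡ true → v b ≡ true → rank v a ≡ rank v b → a ≡ b
  rank-injective {a} {b} va vb eq with <-cmp a b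
  ... | tri≈ _ a≡b _ = a≡b
  ... | tri< a<b _ _ = ⊥-elim (<-irrefl eq (rank-strict a<b va))
  ... | tri> _ _ b<a = ⊥-elim (<-irrefl (sym eq) (rank-strict b<a vb))

  rank-step⇒consecutive : ∀ {a c} → v a ≡ true → v c ≡ true → rank v c ≡ suc (rank v a) →
                          Consecutive v a c
  rank-step⇒consecutive {a} {c} va vc eq = record
    { lower<upper = a<c ; lower = va ; upper = vc ; gap = gap }
    where
    a<c : a < c
    a<c with <-cmp a c
    ... | tri< a<c _ _ = a<c
    ... | tri≈ _ refl _ = ⊥-elim (<-irrefl eq (n<1+n (rank v a)))
    ... | tri> _ _ c<a = ⊥-elim (1+n≰n (≤-trans (n≤1+n _)
                                   (subst (λ r → suc r ≤ rank v a) eq (rank-strict c<a vc))))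
    gap : ∀ m → a < m → m < c → v m ≡ false
    gap m a<m m<c with v m in vm
    ... | false = refl
    ... | true  = ⊥-elim (<-irrefl refl
                   (≤-trans (s≤s (rank-strict a<m va)) (subst (suc (rank v m) ≤_) eq (rank-strict m<c vm))))

record PathLike (G : LatticeGraph) (N : ℕ) : Set where
  open LatticeGraph G
  field
    index      : Point len wid → ℕ
    index<     : ∀ p → vert p ≡ true → index p < N
    index-onto : ∀ k → k < N → Σ (Point len wid) λ p → vert p ≡ true × index p ≡ k
    index-inj  : ∀ p q → vert p ≡ true → vert q ≡ true → index p ≡ index q → p ≡ q
    edge⇒step  : ∀ p q → edge p q ≡ true → vert p ≡ true × vert q ≡ true × Step (index p) (index q)
    step⇒edge  : ∀ p q → vert p ≡ true → vert q ≡ true → Step (index p) (index q) → edge p q ≡ true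

mate : ℕ → ℕ
mate 0 = 1
mate 1 = 0
mate (suc (suc r)) = suc (suc (mate r))

mate-involutive : ∀ r → mate (mate r) ≡ r
mate-involutive 0 = refl
mate-involutive 1 = refl
mate-involutive (suc (suc r)) = cong (suc ∘ suc) (mate-involutive r)

mate-step : ∀ r → Step r (mate r)
mate-step 0 = inj₁ refl
mate-step 1 = inj₂ refl
mate-step (suc (suc r)) with mate-step r
... | inj₁ up   = inj₁ (cong (suc ∘ suc) up)
... | inj₂ down = inj₂ (cong (suc ∘ suc) down)

mate-< : ∀ k {r} → r < 2 * k → mate r < 2 * k
mate-< (suc k) {r} r< =
  subst (mate r <_) (sym (*-suc 2 k)) (mate-<-suc r (subst (r <_) (*-suc 2 k) r<))
  where
  mate-<-suc : ∀ r → r < 2 + 2 * k → mate r < 2 + 2 * k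
  mate-<-suc 0 _ = s≤s (s≤s z≤n)
  mate-<-suc 1 _ = s≤s z≤n
  mate-<-suc (suc (suc r)) (s≤s (s≤s r<)) = s≤s (s≤s (mate-< k r<))

∧-true : ∀ {a b} → a ∧ b ≡ true → a ≡ true × b ≡ true
∧-true {true} {true} _ = refl , refl

does-true : ∀ {A : Set} (d : Dec A) → does d ≡ true → A
does-true (yes a) _ = a

module PathFacts {G : LatticeGraph} {N : ℕ} (path : PathLike G N) where
  open LatticeGraph G
  open PathLike path

  -- Colouring by the parity of the index is proper, since edges join
  -- neighbouring indices.
  path-bipartite : Bipartite G
  path-bipartite = (λ p → isOdd (index p)) ,
    λ p q e → step-flips-parity (proj₂ (proj₂ (edge⇒step p q e)))

  mateMatching : Point len wid → Point len wid → Bool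
  mateMatching p q = vert p ∧ vert q ∧ does (index q ≟ mate (index p))

  mateMatching-true : ∀ {p q} → vert p ≡ true → vert q ≡ true → index q ≡ mate (index p) →
                      mateMatching p q ≡ true
  mateMatching-true {p} {q} vp vq iq rewrite vp | vq = dec-true (index q ≟ mate (index p)) iq

  mateMatching-spec : ∀ {p q} → mateMatching p q ≡ true →
                      vert p ≡ true × vert q ≡ true × index q ≡ mate (index p)
  mateMatching-spec {p} {q} m with ∧-true m
  ... | vp , rest with ∧-true rest
  ...   | vq , iq = vp , vq , does-true (index q ≟ mate (index p)) iq

  even⇒perfect-matching : Even N → HasPerfectMatching G
  even⇒perfect-matching (k , N≡2k) = mateMatching , in-edges , symmetric , perfect
    where
    in-edges : ∀ p q → mateMatching p q ≡ true → edge p q ≡ true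
    in-edges p q m with mateMatching-spec m
    ... | vp , vq , iq = step⇒edge p q vp vq (subst (Step (index p)) (sym iq) (mate-step (index p)))
    symmetric : ∀ p q → mateMatching p q ≡ true → mateMatching q p ≡ true
    symmetric p q m with mateMatching-spec m
    ... | vp , vq , iq = mateMatching-true vq vp
                           (trans (sym (mate-involutive (index p))) (cong mate (sym iq)))
    perfect : ∀ p → vert p ≡ true →
              Σ (Point len wid) λ q → (mateMatching p q ≡ true) × (∀ q' → mateMatching p q' ≡ true → q' ≡ q)
    perfect p vp with index-onto (mate (index p))
                        (subst (mate (index p) <_) (sym N≡2k)
                          (mate-< k (subst (index p <_) N≡2k (index< p vp))))
    ... | q , vq , iq = q , mateMatching-true vp vq iq , unique
      where
      unique : ∀ q' → mateMatching p q' ≡ true → q' ≡ q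
      unique q' m' with mateMatching-spec m'
      ... | _ , vq' , iq' = index-inj q' q vq' vq (trans iq' (sym iq))

  module _ (pm : HasPerfectMatching G) where
    private
      M = proj₁ pm
      M⇒edge = proj₁ (proj₂ pm)
      M-sym = proj₁ (proj₂ (proj₂ pm))
      M-perfect = proj₂ (proj₂ (proj₂ pm))

    -- In any perfect matching the vertex of index 2j is matched upwards,
    -- to the vertex of index 2j+1: matching it downwards would leave the
    -- vertex of index 2j-1 (matched upwards by induction) with two partners.
    matched-upwards : ∀ j p q → index p ≡ 2 * j → M p q ≡ true → index q ≡ suc (2 * j)
    matched-upwards j p q ip m with edge⇒step p q (M⇒edge p q m)
    ... | _ , _ , inj₁ up = trans up (cong suc ip)
    matched-upwards zero p q ip m | _ , _ , inj₂ down with trans (sym ip) down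
    ... | ()
    matched-upwards (suc j) p q ip m | _ , vq , inj₂ down =
      ⊥-elim (<-irrefl index-clash (<-trans (n<1+n (2 * j)) (n<1+n _)))
      where
      iq : index q ≡ suc (2 * j)
      iq = suc-injective (trans (sym down) (trans ip (*-suc 2 j)))
      lower = index-onto (2 * j) (<-trans (subst (2 * j <_) (sym iq) ≤-refl) (index< q vq))
      p' = proj₁ lower
      vp' = proj₁ (proj₂ lower)
      ip' = proj₂ (proj₂ lower)
      partner = M-perfect p' vp'
      q' = proj₁ partner
      m' = proj₁ (proj₂ partner)
      vq' = proj₁ (proj₂ (edge⇒step p' q' (M⇒edge p' q' m')))
      q'≡q : q' ≡ q
      q'≡q = index-inj q' q vq' vq (trans (matched-upwards j p' q' ip' m') (sym iq))
      p≡p' : p ≡ p'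
      p≡p' = trans (proj₂ (proj₂ (M-perfect q vq)) p (M-sym p q m))
                   (sym (proj₂ (proj₂ (M-perfect q vq)) p' (M-sym p' q (subst (λ r → M p' r ≡ true) q'≡q m'))))
      index-clash : 2 * j ≡ suc (suc (2 * j))
      index-clash = trans (sym ip') (trans (cong index (sym p≡p')) (trans ip (*-suc 2 j)))

    -- With an odd number 2j+1 of vertices, the top vertex (index 2j) would
    -- have to be matched to a vertex of index 2j+1, which does not exist.
    perfect-matching⇒even : Even N
    perfect-matching⇒even with even-or-odd N
    ... | inj₁ even = even
    ... | inj₂ (j , N≡) = ⊥-elim (<-irrefl (trans (matched-upwards j p q ip m) (sym N≡)) (index< q vq))
      where
      top = index-onto (2 * j) (subst (2 * j <_) (sym N≡) ≤-refl)
      p = proj₁ top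
      vp = proj₁ (proj₂ top)
      ip = proj₂ (proj₂ top)
      q = proj₁ (M-perfect p vp)
      m = proj₁ (proj₂ (M-perfect p vp))
      vq = proj₁ (proj₂ (edge⇒step p q (M⇒edge p q m)))

  path-matching⇔even : HasPerfectMatching G ⇔ Even N
  path-matching⇔even = mk⇔ perfect-matching⇒even even⇒perfect-matching

-- The embedding of row numbers into the rationals used by pos; it is kept
-- opaque so that the normalisation of fractions is never unfolded.
opaque
  ι : ℕ → ℚ
  ι a = (ℤ.+ a) ℚ./ 1

  ι-pos : ∀ a → (ℤ.+ a) ℚ./ 1 ≡ ι a
  ι-pos a = refl

  ι≡mkℚ : ∀ a → ι a ≡ mkℚ (ℤ.+ a) 0 (Coprime.sym (1-coprimeTo a))
  ι≡mkℚ a = ℚP.normalize-coprime (Coprime.sym (1-coprimeTo a))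

  ι-mono : ∀ {a b} → a ≤ b → ι a ℚ.≤ ι b
  ι-mono {a} {b} a≤b rewrite ι≡mkℚ a | ι≡mkℚ b =
    ℚ.*≤* (subst₂ ℤ._≤_ (sym (ℤP.*-identityʳ (ℤ.+ a))) (sym (ℤP.*-identityʳ (ℤ.+ b))) (ℤ.+≤+ a≤b))

  ι-cancel : ∀ {a b} → ι a ℚ.≤ ι b → a ≤ b
  ι-cancel {a} {b} ιa≤ιb rewrite ι≡mkℚ a | ι≡mkℚ b with ιa≤ιb
  ... | ℚ.*≤* le rewrite ℤP.*-identityʳ (ℤ.+ a) | ℤP.*-identityʳ (ℤ.+ b) with le
  ...   | ℤ.+≤+ a≤b = a≤b

along : ℚ → ℚ → ℚ → ℚ
along a b s = a ℚ.+ s ℚ.* (b ℚ.- a)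

along-constant : ∀ a s → along a a s ≡ a
along-constant a s = begin
  a ℚ.+ s ℚ.* (a ℚ.- a)  ≡⟨ cong (λ d → a ℚ.+ s ℚ.* d) (ℚP.+-inverseʳ a) ⟩
  a ℚ.+ s ℚ.* 0ℚ         ≡⟨ cong (a ℚ.+_) (ℚP.*-zeroʳ s) ⟩
  a ℚ.+ 0ℚ               ≡⟨ ℚP.+-identityʳ a ⟩
  a                      ∎
  where open ≡-Reasoning

along-end : ∀ a b → a ℚ.+ (b ℚ.- a) ≡ b
along-end a b = begin
  a ℚ.+ (b ℚ.- a)        ≡⟨ cong (a ℚ.+_) (ℚP.+-comm b (ℚ.- a)) ⟩
  a ℚ.+ (ℚ.- a ℚ.+ b)    ≡⟨ ℚP.+-assoc a (ℚ.- a) b ⟨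
  (a ℚ.+ ℚ.- a) ℚ.+ b    ≡⟨ cong (ℚ._+ b) (ℚP.+-inverseʳ a) ⟩
  0ℚ ℚ.+ b               ≡⟨ ℚP.+-identityˡ b ⟩
  b                      ∎
  where open ≡-Reasoning

along-up : ∀ a b s → 0ℚ ℚ.≤ s → s ℚ.≤ 1ℚ → a ℚ.≤ b → a ℚ.≤ along a b s × along a b s ℚ.≤ b
along-up a b s 0≤s s≤1 a≤b = above-a , below-b
  where
  d = b ℚ.- a
  0≤d : 0ℚ ℚ.≤ d
  0≤d = subst (ℚ._≤ d) (ℚP.+-inverseʳ a) (ℚP.+-monoˡ-≤ (ℚ.- a) a≤b)
  instance d-nonNeg = ℚ.nonNegative 0≤d
  above-a = subst (ℚ._≤ along a b s) (ℚP.+-identityʳ a)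
              (ℚP.+-monoʳ-≤ a (subst (ℚ._≤ s ℚ.* d) (ℚP.*-zeroˡ d) (ℚP.*-monoʳ-≤-nonNeg d 0≤s)))
  below-b = subst (along a b s ℚ.≤_) (along-end a b)
              (ℚP.+-monoʳ-≤ a (subst (s ℚ.* d ℚ.≤_) (ℚP.*-identityˡ d) (ℚP.*-monoʳ-≤-nonNeg d s≤1)))

along-down : ∀ a b s → 0ℚ ℚ.≤ s → s ℚ.≤ 1ℚ → b ℚ.≤ a → b ℚ.≤ along a b s × along a b s ℚ.≤ a
along-down a b s 0≤s s≤1 b≤a = above-b , below-a
  where
  d = b ℚ.- a
  d≤0 : d ℚ.≤ 0ℚ
  d≤0 = subst (d ℚ.≤_) (ℚP.+-inverseʳ a) (ℚP.+-monoˡ-≤ (ℚ.- a) b≤a)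
  instance d-nonPos = ℚ.nonPositive d≤0
  below-a = subst (along a b s ℚ.≤_) (ℚP.+-identityʳ a)
              (ℚP.+-monoʳ-≤ a (subst (s ℚ.* d ℚ.≤_) (ℚP.*-zeroˡ d) (ℚP.*-monoʳ-≤-nonPos d 0≤s)))
  above-b = subst (ℚ._≤ along a b s) (along-end a b)
              (ℚP.+-monoʳ-≤ a (subst (ℚ._≤ s ℚ.* d) (ℚP.*-identityˡ d) (ℚP.*-monoʳ-≤-nonPos d s≤1)))

nothing-inside : ∀ {v a b m} → Consecutive v a b → a < m → m < b → v m ≢ true
nothing-inside ab a<m m<b vm with trans (sym (Consecutive.gap ab _ a<m m<b)) vm
... | ()

consecutive-overlap : ∀ {v a b c d} → Consecutive v a b → Consecutive v c d →
                      b ≤ c ⊎ d ≤ a ⊎ (a ≡ c × b ≡ d)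
consecutive-overlap {a = a} {b} {c} {d} ab cd with b ≤? c | d ≤? a
... | yes b≤c | _       = inj₁ b≤c
... | no _    | yes d≤a = inj₂ (inj₁ d≤a)
... | no b≰c  | no d≰a with <-cmp a c | <-cmp b d
...   | tri< a<c _ _ | _ =
        ⊥-elim (nothing-inside ab a<c (≰⇒> b≰c) (Consecutive.lower cd))
...   | tri> _ _ c<a | _ =
        ⊥-elim (nothing-inside cd c<a (≰⇒> d≰a) (Consecutive.lower ab))
...   | tri≈ _ refl _ | tri< b<d _ _ =
        ⊥-elim (nothing-inside cd (Consecutive.lower<upper ab) b<d (Consecutive.upper ab))
...   | tri≈ _ refl _ | tri> _ _ d<b =
        ⊥-elim (nothing-inside ab (Consecutive.lower<upper cd) d<b (Consecutive.upper cd))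
...   | tri≈ _ a≡c _ | tri≈ _ b≡d _ = inj₂ (inj₂ (a≡c , b≡d))

meet-at-row : ∀ {b c y} → b ≤ c → y ℚ.≤ ι b → ι c ℚ.≤ y → b ≡ c × y ≡ ι b
meet-at-row b≤c y≤b c≤y =
  ≤-antisym b≤c (ι-cancel (ℚP.≤-trans c≤y y≤b)) ,
  ℚP.≤-antisym y≤b (ℚP.≤-trans (ι-mono b≤c) c≤y)

row : ∀ {L W} → Point L W → ℕ
row p = toℕ (proj₂ p)

columnGraph : ℕ → (ℕ → Bool) → (ℕ → ℕ → Bool) → LatticeGraph
columnGraph W v e = record
  { len = 1 ; wid = W ; vert = λ p → v (row p) ; edge = λ p q → e (row p) (row q) }

JoinsConsecutive : ℕ → (ℕ → Bool) → (ℕ → ℕ → Bool) → Set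
JoinsConsecutive W v e = ∀ a c → a < W → c < W → (e a c ≡ true ⇔ Adjacent v a c)

module ColumnGraph (W : ℕ) (v : ℕ → Bool) (e : ℕ → ℕ → Bool) (joins : JoinsConsecutive W v e) where
  open RankProperties v

  private
    Pt = Point 1 W

  G : LatticeGraph
  G = columnGraph W v e

  row< : (p : Pt) → row p < W
  row< p = toℕ<n (proj₂ p)

  row-injective : ∀ {p q : Pt} → row p ≡ row q → p ≡ q
  row-injective {Fin.zero , i} {Fin.zero , j} eq = cong (Fin.zero ,_) (toℕ-injective eq)

  pos-column : (p : Pt) → pos p ≡ (ι 0 , ι (row p))
  pos-column (Fin.zero , i) = cong₂ _,_ (ι-pos 0) (ι-pos (toℕ i))

  on-column-segment : ∀ (p q : Pt) {x y} → OnSegment (x , y) (pos p) (pos q) →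
    Σ ℚ λ s → 0ℚ ℚ.≤ s × s ℚ.≤ 1ℚ × x ≡ ι 0 × y ≡ along (ι (row p)) (ι (row q)) s
  on-column-segment (Fin.zero , i) (Fin.zero , j) (s , 0≤s , s≤1 , x≡ , y≡) =
    s , 0≤s , s≤1 , trans x≡ (trans (along-constant _ s) (ι-pos 0)) ,
    trans y≡ (cong₂ (λ a b → along a b s) (ι-pos (toℕ i)) (ι-pos (toℕ j)))

  adjacent : ∀ p q → e (row p) (row q) ≡ true → Adjacent v (row p) (row q)
  adjacent p q = Equivalence.to (joins (row p) (row q) (row< p) (row< q))

  join : ∀ p q → Adjacent v (row p) (row q) → e (row p) (row q) ≡ true
  join p q = Equivalence.from (joins (row p) (row q) (row< p) (row< q))

  adjacent-vertices : ∀ {a c} → Adjacent v a c → v a ≡ true × v c ≡ true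
  adjacent-vertices (inj₁ ac) = Consecutive.lower ac , Consecutive.upper ac
  adjacent-vertices (inj₂ ca) = Consecutive.upper ca , Consecutive.lower ca

  adjacent-distinct : ∀ {a c} → Adjacent v a c → a ≢ c
  adjacent-distinct (inj₁ ac) refl = <-irrefl refl (Consecutive.lower<upper ac)
  adjacent-distinct (inj₂ ca) refl = <-irrefl refl (Consecutive.lower<upper ca)

  column-wellFormed : WellFormed G
  column-wellFormed p@(Fin.zero , _) q@(Fin.zero , _) pq =
    proj₁ (adjacent-vertices adj) , proj₂ (adjacent-vertices adj) ,
    adjacent-distinct adj ∘ cong row , join q p (swap adj) , z≤n
    where adj = adjacent p q pq

  column-path : PathLike G (rank v W)
  column-path = record
    { index      = λ p → rank v (row p)
    ; index<     = λ p vp → rank-strict (row< p) vp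
    ; index-onto = onto
    ; index-inj  = λ p q vp vq eq → row-injective (rank-injective vp vq eq)
    ; edge⇒step  = edge⇒step
    ; step⇒edge  = step⇒edge
    }
    where
    onto : ∀ k → k < rank v W → Σ Pt λ p → v (row p) ≡ true × rank v (row p) ≡ k
    onto k k< with rank-onto W k k<
    ... | r , r<W , vr , rk rewrite sym (toℕ-fromℕ< r<W) = (Fin.zero , fromℕ< r<W) , vr , rk
    edge⇒step : ∀ p q → e (row p) (row q) ≡ true →
                v (row p) ≡ true × v (row q) ≡ true × Step (rank v (row p)) (rank v (row q))
    edge⇒step p q pq with adjacent p q pq
    ... | inj₁ pq↑ = Consecutive.lower pq↑ , Consecutive.upper pq↑ , inj₁ (consecutive⇒rank-step pq↑)
    ... | inj₂ qp↑ = Consecutive.upper qp↑ , Consecutive.lower qp↑ , inj₂ (consecutive⇒rank-step qp↑)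
    step⇒edge : ∀ p q → v (row p) ≡ true → v (row q) ≡ true →
                Step (rank v (row p)) (rank v (row q)) → e (row p) (row q) ≡ true
    step⇒edge p q vp vq (inj₁ up)   = join p q (inj₁ (rank-step⇒consecutive vp vq up))
    step⇒edge p q vp vq (inj₂ down) = join p q (inj₂ (rank-step⇒consecutive vq vp down))

  Ends : Pt → Pt → Pt → Pt → Set
  Ends l h p q = (l ≡ p × h ≡ q) ⊎ (l ≡ q × h ≡ p)

  lower-end : ∀ {l h p q} → Ends l h p q → l ≡ p ⊎ l ≡ q
  lower-end (inj₁ (l≡p , _)) = inj₁ l≡p
  lower-end (inj₂ (l≡q , _)) = inj₂ l≡q

  upper-end : ∀ {l h p q} → Ends l h p q → h ≡ p ⊎ h ≡ q
  upper-end (inj₁ (_ , h≡q)) = inj₂ h≡q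
  upper-end (inj₂ (_ , h≡p)) = inj₁ h≡p

  same-ends : ∀ {l h p q p' q'} → Ends l h p q → Ends l h p' q' → (p ≡ p' × q ≡ q') ⊎ (p ≡ q' × q ≡ p')
  same-ends (inj₁ (refl , refl)) (inj₁ (refl , refl)) = inj₁ (refl , refl)
  same-ends (inj₁ (refl , refl)) (inj₂ (refl , refl)) = inj₂ (refl , refl)
  same-ends (inj₂ (refl , refl)) (inj₁ (refl , refl)) = inj₂ (refl , refl)
  same-ends (inj₂ (refl , refl)) (inj₂ (refl , refl)) = inj₁ (refl , refl)

  record PointOnEdge (p q : Pt) (x y : ℚ) : Set where
    field
      low high    : Pt
      ends        : Ends low high p q
      consecutive : Consecutive v (row low) (row high)
      in-column   : x ≡ ι 0
      above-low   : ι (row low) ℚ.≤ y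
      below-high  : y ℚ.≤ ι (row high)

  point-on-edge : ∀ p q {x y} → e (row p) (row q) ≡ true → OnSegment (x , y) (pos p) (pos q) →
                  PointOnEdge p q x y
  point-on-edge p q pq on with on-column-segment p q on | adjacent p q pq
  ... | s , 0≤s , s≤1 , x≡ , y≡ | inj₁ pq↑ = record
    { low = p ; high = q ; ends = inj₁ (refl , refl) ; consecutive = pq↑ ; in-column = x≡
    ; above-low = subst (_ ℚ.≤_) (sym y≡) (proj₁ between)
    ; below-high = subst (ℚ._≤ _) (sym y≡) (proj₂ between) }
    where between = along-up _ _ s 0≤s s≤1 (ι-mono (<⇒≤ (Consecutive.lower<upper pq↑)))
  ... | s , 0≤s , s≤1 , x≡ , y≡ | inj₂ qp↑ = record
    { low = q ; high = p ; ends = inj₂ (refl , refl) ; consecutive = qp↑ ; in-column = x≡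
    ; above-low = subst (_ ℚ.≤_) (sym y≡) (proj₁ between)
    ; below-high = subst (ℚ._≤ _) (sym y≡) (proj₂ between) }
    where between = along-down _ _ s 0≤s s≤1 (ι-mono (<⇒≤ (Consecutive.lower<upper qp↑)))

  -- No edge passes through a third vertex: such a vertex would lie strictly
  -- between two consecutive vertex rows.
  no-vertex-on-edge : ∀ (w p q : Pt) → v (row w) ≡ true → e (row p) (row q) ≡ true →
                      w ≢ p → w ≢ q → ¬ OnSegment (pos w) (pos p) (pos q)
  no-vertex-on-edge w p q vw pq w≢p w≢q on =
    nothing-inside consecutive
      (≤∧≢⇒< (ι-cancel above-low) (not-an-end (lower-end ends) ∘ row-injective ∘ sym))
      (≤∧≢⇒< (ι-cancel below-high) (not-an-end (upper-end ends) ∘ row-injective))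
      vw
    where
    open PointOnEdge (point-on-edge p q pq (subst (λ X → OnSegment X (pos p) (pos q)) (pos-column w) on))
    not-an-end : ∀ {r} → r ≡ p ⊎ r ≡ q → w ≢ r
    not-an-end (inj₁ refl) = w≢p
    not-an-end (inj₂ refl) = w≢q

  MeetAtEnds : Pt → Pt → Pt → Pt → ℚ² → Set
  MeetAtEnds p q p' q' X = ((p ≡ p' × q ≡ q') ⊎ (p ≡ q' × q ≡ p')) ⊎
    (Σ Pt λ r → (r ≡ p ⊎ r ≡ q) × (r ≡ p' ⊎ r ≡ q') × (X ≡ pos r))

  -- Two drawn edges through a common point either coincide or meet at a
  -- common end, since their row intervals overlap only in that way.
  meet-at-ends : ∀ {p q p' q' x y} → PointOnEdge p q x y → PointOnEdge p' q' x y →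
                 MeetAtEnds p q p' q' (x , y)
  meet-at-ends
    record { low = l ; high = h ; ends = ends ; consecutive = lh ; in-column = x≡
           ; above-low = l≤y ; below-high = y≤h }
    record { low = l' ; high = h' ; ends = ends' ; consecutive = l'h'
           ; above-low = l'≤y ; below-high = y≤h' }
    with consecutive-overlap lh l'h'
  ... | inj₁ h≤l' =
    inj₂ (h , upper-end ends , subst (λ r → r ≡ _ ⊎ r ≡ _) (sym (row-injective rows)) (lower-end ends') ,
          trans (cong₂ _,_ x≡ y≡) (sym (pos-column h)))
    where open Σ (meet-at-row h≤l' y≤h l'≤y) renaming (proj₁ to rows; proj₂ to y≡)
  ... | inj₂ (inj₁ h'≤l) =
    inj₂ (l , lower-end ends , subst (λ r → r ≡ _ ⊎ r ≡ _) (row-injective rows) (upper-end ends') ,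
          trans (cong₂ _,_ x≡ (trans y≡ (cong ι rows))) (sym (pos-column l)))
    where open Σ (meet-at-row h'≤l y≤h' l≤y) renaming (proj₁ to rows; proj₂ to y≡)
  ... | inj₂ (inj₂ (l≡l' , h≡h')) =
    inj₁ (same-ends ends (subst₂ (λ a b → Ends a b _ _) (sym (row-injective l≡l')) (sym (row-injective h≡h')) ends'))

  column-planar : PlanarEmbedding G
  column-planar = no-vertex-on-edge ,
    λ p q p' q' pq pq' X on on' → meet-at-ends (point-on-edge p q pq on) (point-on-edge p' q' pq' on')

  column-gridLayeredPlanar : GridLayeredPlanar G
  column-gridLayeredPlanar = column-wellFormed , column-planar

data SameGraph : LatticeGraph → LatticeGraph → Set where
  same : ∀ {L W} {v v' : Point L W → Bool} {e e' : Point L W → Point L W → Bool} →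
         (∀ p → v p ≡ v' p) → (∀ p q → e p q ≡ e' p q) →
         SameGraph (record { len = L ; wid = W ; vert = v ; edge = e })
                   (record { len = L ; wid = W ; vert = v' ; edge = e' })

same-perfect-matching : ∀ {G H} → SameGraph G H → HasPerfectMatching G → HasPerfectMatching H
same-perfect-matching (same v≡ e≡) (M , M⇒edge , M-sym , M-perfect) =
  M , (λ p q m → trans (sym (e≡ p q)) (M⇒edge p q m)) , M-sym ,
  (λ p vp → M-perfect p (trans (v≡ p) vp))

unary-header-injective : ∀ a b (u w : List Bool) →
  replicate a true ++ false ∷ u ≡ replicate b true ++ false ∷ w → a ≡ b × u ≡ w
unary-header-injective zero    zero    u w eq = refl , proj₂ (∷-injective eq)
unary-header-injective (suc a) (suc b) u w eq with unary-header-injective a b u w (proj₂ (∷-injective eq))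
... | refl , u≡w = refl , u≡w

++-injective : ∀ {A : Set} (xs ys : List A) {u w} → length xs ≡ length ys → xs ++ u ≡ ys ++ w →
               xs ≡ ys × u ≡ w
++-injective []       []       _   eq = refl , eq
++-injective (x ∷ xs) (y ∷ ys) len eq with ∷-injective eq
... | refl , eq' with ++-injective xs ys (suc-injective len) eq'
...   | refl , u≡w = refl , u≡w

map-pointwise : ∀ {A B : Set} (f g : A → B) xs → map f xs ≡ map g xs → ∀ {a} → a ∈ xs → f a ≡ g a
map-pointwise f g (x ∷ xs) eq (here refl) = proj₁ (∷-injective eq)
map-pointwise f g (x ∷ xs) eq (there a∈xs) = map-pointwise f g xs (proj₂ (∷-injective eq)) a∈xs

concatMap-pointwise : ∀ {A B : Set} (f g : A → List B) xs → (∀ a → length (f a) ≡ length (g a)) →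
                      concatMap f xs ≡ concatMap g xs → ∀ {a} → a ∈ xs → f a ≡ g a
concatMap-pointwise f g (x ∷ xs) len eq (here refl) = proj₁ (++-injective (f x) (g x) (len x) eq)
concatMap-pointwise f g (x ∷ xs) len eq (there a∈xs) =
  concatMap-pointwise f g xs len (proj₂ (++-injective (f x) (g x) (len x) eq)) a∈xs

∈-points : ∀ {L W} (p : Point L W) → p ∈ points L W
∈-points (a , b) = ∈-cartesianProduct⁺ (∈-allFin a) (∈-allFin b)

encode-injective : ∀ G H → encode G ≡ encode H → SameGraph G H
encode-injective record { len = L ; wid = W ; vert = v ; edge = e }
                 record { len = L' ; wid = W' ; vert = v' ; edge = e' } eq
  with unary-header-injective L L' _ _ eq
... | refl , eq₁ with unary-header-injective W W' _ _ eq₁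
...   | refl , eq₂ = same vertices edges
  where
  pts = points L W
  parts = ++-injective (map v pts) (map v' pts) (trans (length-map v pts) (sym (length-map v' pts))) eq₂
  vertices : ∀ p → v p ≡ v' p
  vertices p = map-pointwise v v' pts (proj₁ parts) (∈-points p)
  edges : ∀ p q → e p q ≡ e' p q
  edges p q = map-pointwise (e p) (e' p) pts
    (concatMap-pointwise (λ r → map (e r) pts) (λ r → map (e' r) pts) pts
      (λ r → trans (length-map (e r) pts) (sym (length-map (e' r) pts))) (proj₂ parts) (∈-points p))
    (∈-points q)

data Literal : Set where
  const : Bool → Literal
  var   : ℕ → Literal
  nvar  : ℕ → Literal

-- The input bit x_j, read as 0 beyond the end of the input.
bitAt : List Bool → ℕ → Bool
bitAt []       _       = false
bitAt (b ∷ _)  zero    = b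
bitAt (_ ∷ xs) (suc j) = bitAt xs j

eval : List Bool → Literal → Bool
eval xs (const b) = b
eval xs (var j)   = bitAt xs j
eval xs (nvar j)  = not (bitAt xs j)

shift : Literal → Literal
shift (const b) = const b
shift (var j)   = var (suc j)
shift (nvar j)  = nvar (suc j)

eval-shift : ∀ b xs l → eval (b ∷ xs) (shift l) ≡ eval xs l
eval-shift b xs (const _) = refl
eval-shift b xs (var _)   = refl
eval-shift b xs (nvar _)  = refl

literalGraph : List Bool → (L W : ℕ) → (Point L W → Literal) → (Point L W → Point L W → Literal) →
               LatticeGraph
literalGraph xs L W vl el = record
  { len = L ; wid = W ; vert = λ p → eval xs (vl p) ; edge = λ p q → eval xs (el p q) }

encodeLiterals : (L W : ℕ) → (Point L W → Literal) → (Point L W → Point L W → Literal) → List Literal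
encodeLiterals L W vl el =
  replicate L (const true) ++ const false ∷ replicate W (const true) ++ const false ∷
  map vl (points L W) ++ concatMap (λ p → map (el p) (points L W)) (points L W)

encode-literalGraph : ∀ xs L W vl el →
  map (eval xs) (encodeLiterals L W vl el) ≡ encode (literalGraph xs L W vl el)
encode-literalGraph xs L W vl el = begin
  map ev (replicate L (const true) ++ const false ∷ replicate W (const true) ++ const false ∷ body)
    ≡⟨ map-++ ev (replicate L _) _ ⟩
  map ev (replicate L (const true)) ++ false ∷ map ev (replicate W (const true) ++ const false ∷ body)
    ≡⟨ cong₂ (λ u w → u ++ false ∷ w) (map-replicate ev L _) (map-++ ev (replicate W _) _) ⟩
  replicate L true ++ false ∷ map ev (replicate W (const true)) ++ false ∷ map ev body
    ≡⟨ cong₂ (λ u w → replicate L true ++ false ∷ u ++ false ∷ w) (map-replicate ev W _) (map-++ ev (map vl pts) _) ⟩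
  replicate L true ++ false ∷ replicate W true ++ false ∷
    map ev (map vl pts) ++ map ev (concatMap (λ p → map (el p) pts) pts)
    ≡⟨ cong₂ (λ u w → replicate L true ++ false ∷ replicate W true ++ false ∷ u ++ w)
             (sym (map-∘ pts)) (map-concatMap ev (λ p → map (el p) pts) pts) ⟩
  replicate L true ++ false ∷ replicate W true ++ false ∷
    map (ev ∘ vl) pts ++ concatMap (λ p → map ev (map (el p) pts)) pts
    ≡⟨ cong (λ w → replicate L true ++ false ∷ replicate W true ++ false ∷ map (ev ∘ vl) pts ++ w)
            (concatMap-cong (λ p → sym (map-∘ pts)) pts) ⟩
  encode (literalGraph xs L W vl el)
    ∎
  where
  open ≡-Reasoning
  ev = eval xs
  pts = points L W
  body = map vl pts ++ concatMap (λ p → map (el p) pts) pts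

at : ∀ {A : Set} {k} → A → Vec A k → ℕ → A
at d Vec.[]      _       = d
at d (a Vec.∷ v) zero    = a
at d (a Vec.∷ v) (suc m) = at d v m

-- Gate values and depths are read through `at` to avoid casts between
-- indices of growing circuits.
lookup-at : ∀ {A : Set} {k} d (v : Vec A k) (i : Fin k) → lookup v i ≡ at d v (toℕ i)
lookup-at d (a Vec.∷ v) Fin.zero    = refl
lookup-at d (a Vec.∷ v) (Fin.suc i) = lookup-at d v i

at-∷ʳ-old : ∀ {A : Set} {k} d (v : Vec A k) a {m} → m < k → at d (v ∷ʳ a) m ≡ at d v m
at-∷ʳ-old d (b Vec.∷ v) a {zero}  _         = refl
at-∷ʳ-old d (b Vec.∷ v) a {suc m} (s≤s m<k) = at-∷ʳ-old d v a m<k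

at-∷ʳ-new : ∀ {A : Set} {k} d (v : Vec A k) a → at d (v ∷ʳ a) k ≡ a
at-∷ʳ-new d Vec.[]      a = refl
at-∷ʳ-new d (b Vec.∷ v) a = at-∷ʳ-new d v a

at-∷ʳ-all : ∀ {A : Set} {k} (Q : A → Set) d (v : Vec A k) a →
            (∀ m → Q (at d v m)) → Q a → Q d → ∀ m → Q (at d (v ∷ʳ a) m)
at-∷ʳ-all Q d Vec.[]      a _   Qa _  zero    = Qa
at-∷ʳ-all Q d Vec.[]      a _   _  Qd (suc m) = Qd
at-∷ʳ-all Q d (b Vec.∷ v) a Qv  _  _  zero    = Qv zero
at-∷ʳ-all Q d (b Vec.∷ v) a Qv  Qa Qd (suc m) = at-∷ʳ-all Q d v a (Qv ∘ suc) Qa Qd m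

at-toList : ∀ {k} (x : Vec Bool k) m → at false x m ≡ bitAt (toList x) m
at-toList Vec.[]      m       = refl
at-toList (b Vec.∷ x) zero    = refl
at-toList (b Vec.∷ x) (suc m) = at-toList x m

bitAt-beyond : ∀ xs {m} → length xs ≤ m → bitAt xs m ≡ false
bitAt-beyond []       _         = refl
bitAt-beyond (b ∷ xs) (s≤s len) = bitAt-beyond xs len

max-lookup-≤ : ∀ {k b} (ds : Vec ℕ k) → (∀ i → lookup ds i ≤ b) → ∀ is →
               List.foldr _⊔_ 0 (map (lookup ds) is) ≤ b
max-lookup-≤ ds bound []       = z≤n
max-lookup-≤ ds bound (i ∷ is) = ⊔-lub (bound i) (max-lookup-≤ ds bound is)

n≤n³ : ∀ n → n ≤ n ^ 3
n≤n³ zero    = z≤n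
n≤n³ (suc m) = m≤m*n (suc m) (suc m * (suc m * 1))

-- The circuit on n inputs computing every literal: the n input gates, then
-- the negations of the inputs, then the constants true (empty AND) and
-- false (empty OR).
module LiteralCircuit (n : ℕ) where

  inputs : (k : ℕ) → k ≤ n → Circ n k
  inputs zero    _   = []
  inputs (suc k) k<n = inputs k (<⇒≤ k<n) ▷ input (fromℕ< k<n)

  negations : (k : ℕ) → k ≤ n → Circ n (k + n)
  negations zero    _   = inputs n ≤-refl
  negations (suc k) k<n = negations k (<⇒≤ k<n) ▷ neg (fromℕ< (≤-trans k<n (m≤n+m n k)))

  K : ℕ
  K = suc (suc (n + n))

  literalGates : Circ n K
  literalGates = (negations n ≤-refl ▷ and []) ▷ or []

  -- the gate computing a literal (input bits past the end read as 0)
  gateOf : Literal → ℕ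
  gateOf (const true)  = n + n
  gateOf (const false) = suc (n + n)
  gateOf (var j) with j <? n
  ... | yes _ = j
  ... | no _  = suc (n + n)
  gateOf (nvar j) with j <? n
  ... | yes _ = j + n
  ... | no _  = n + n

  gateOf< : ∀ l → gateOf l < K
  gateOf< (const true)  = m≤n⇒m≤1+n ≤-refl
  gateOf< (const false) = ≤-refl
  gateOf< (var j) with j <? n
  ... | yes j<n = ≤-trans j<n (≤-trans (m≤m+n n n) (m≤n⇒m≤1+n (n≤1+n _)))
  ... | no _    = ≤-refl
  gateOf< (nvar j) with j <? n
  ... | yes j<n = ≤-trans (+-monoˡ-< n j<n) (m≤n⇒m≤1+n (n≤1+n _))
  ... | no _    = m≤n⇒m≤1+n ≤-refl

  queried : List Literal → List (Fin K)
  queried ls = map (λ l → fromℕ< (gateOf< l)) ls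

  query : List Literal → Circuit n
  query ls = circuit K (literalGates ▷ oracle (queried ls))

  module Values (O : List Bool → Bool) (x : Vec Bool n) where
    private
      xs = toList x

    inputs-value : ∀ k k≤n {m} → m < k → at false (values O (inputs k k≤n) x) m ≡ bitAt xs m
    inputs-value (suc k) k<n {m} (s≤s m≤k) with m≤n⇒m<n∨m≡n m≤k
    ... | inj₁ m<k = trans (at-∷ʳ-old false (values O (inputs k (<⇒≤ k<n)) x) _ m<k)
                           (inputs-value k (<⇒≤ k<n) m<k)
    ... | inj₂ refl = begin
      at false (values O (inputs (suc m) k<n) x) m ≡⟨ at-∷ʳ-new false (values O (inputs m (<⇒≤ k<n)) x) _ ⟩
      lookup x (fromℕ< k<n)                         ≡⟨ lookup-at false x (fromℕ< k<n) ⟩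
      at false x (toℕ (fromℕ< k<n))                 ≡⟨ cong (at false x) (toℕ-fromℕ< k<n) ⟩
      at false x m                                  ≡⟨ at-toList x m ⟩
      bitAt xs m                                    ∎
      where open ≡-Reasoning

    negations-input : ∀ k k≤n {m} → m < n → at false (values O (negations k k≤n) x) m ≡ bitAt xs m
    negations-input zero    _   m<n = inputs-value n ≤-refl m<n
    negations-input (suc k) k<n m<n =
      trans (at-∷ʳ-old false (values O (negations k (<⇒≤ k<n)) x) _ (≤-trans m<n (m≤n+m n k)))
            (negations-input k (<⇒≤ k<n) m<n)

    negations-value : ∀ k k≤n {j} → j < k → at false (values O (negations k k≤n) x) (j + n) ≡ not (bitAt xs j)
    negations-value (suc k) k<n {j} (s≤s j≤k) with m≤n⇒m<n∨m≡n j≤k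
    ... | inj₁ j<k = trans (at-∷ʳ-old false (values O (negations k (<⇒≤ k<n)) x) _ (+-monoˡ-< n j<k))
                           (negations-value k (<⇒≤ k<n) j<k)
    ... | inj₂ refl = begin
      at false (vs ∷ʳ not (lookup vs i)) (j + n) ≡⟨ at-∷ʳ-new false vs _ ⟩
      not (lookup vs i)                          ≡⟨ cong not (lookup-at false vs i) ⟩
      not (at false vs (toℕ i))                  ≡⟨ cong (not ∘ at false vs) (toℕ-fromℕ< _) ⟩
      not (at false vs j)                        ≡⟨ cong not (negations-input j (<⇒≤ k<n) k<n) ⟩
      not (bitAt xs j)                           ∎
      where
      open ≡-Reasoning
      vs = values O (negations j (<⇒≤ k<n)) x
      i = fromℕ< (≤-trans k<n (m≤n+m n j))

    private
      vsN = values O (negations n ≤-refl) x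
      vs₁ = vsN ∷ʳ true
      vs  = vs₁ ∷ʳ false
      beforeConstants : ∀ {m} → m < n + n → at false vs m ≡ at false vsN m
      beforeConstants m< = trans (at-∷ʳ-old false vs₁ false (m≤n⇒m≤1+n m<)) (at-∷ʳ-old false vsN true m<)
      beyond : ∀ {j} → ¬ j < n → bitAt xs j ≡ false
      beyond j≮n = bitAt-beyond xs (subst (_≤ _) (sym (length-toList x)) (≮⇒≥ j≮n))

    literalGates-value : ∀ l → at false vs (gateOf l) ≡ eval xs l
    literalGates-value (const true)  = trans (at-∷ʳ-old false vs₁ false ≤-refl) (at-∷ʳ-new false vsN true)
    literalGates-value (const false) = at-∷ʳ-new false vs₁ false
    literalGates-value (var j) with j <? n
    ... | yes j<n = trans (beforeConstants (≤-trans j<n (m≤m+n n n))) (negations-input n ≤-refl j<n)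
    ... | no j≮n  = trans (at-∷ʳ-new false vs₁ false) (sym (beyond j≮n))
    literalGates-value (nvar j) with j <? n
    ... | yes j<n = trans (beforeConstants (+-monoˡ-< n j<n)) (negations-value n ≤-refl j<n)
    ... | no j≮n  = trans (literalGates-value (const true)) (sym (cong not (beyond j≮n)))

    query-output : ∀ ls → output O (query ls) x ≡ O (map (eval xs) ls)
    query-output ls = trans (last-∷ʳ _ vs) (cong O (begin
      map (lookup vs) (map gate ls)          ≡⟨ map-∘ ls ⟨
      map (lookup vs ∘ gate) ls              ≡⟨ map-cong gate-value ls ⟩
      map (eval xs) ls                       ∎))
      where
      open ≡-Reasoning
      gate = λ l → fromℕ< (gateOf< l)
      gate-value : ∀ l → lookup vs (gate l) ≡ eval xs l
      gate-value l = trans (lookup-at false vs (gate l))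
                           (trans (cong (at false vs) (toℕ-fromℕ< (gateOf< l))) (literalGates-value l))

  inputs-depth : ∀ k k≤n m → at 0 (depths (inputs k k≤n)) m ≡ 0
  inputs-depth zero    _   _ = refl
  inputs-depth (suc k) k<n   = at-∷ʳ-all (_≡ 0) 0 (depths (inputs k (<⇒≤ k<n))) 0 (inputs-depth k _) refl refl

  negations-input-depth : ∀ k k≤n {m} → m < n → at 0 (depths (negations k k≤n)) m ≡ 0
  negations-input-depth zero    _   {m} _   = inputs-depth n ≤-refl m
  negations-input-depth (suc k) k<n     m<n =
    trans (at-∷ʳ-old 0 (depths (negations k (<⇒≤ k<n))) _ (≤-trans m<n (m≤n+m n k)))
          (negations-input-depth k (<⇒≤ k<n) m<n)

  negations-depth : ∀ k k≤n m → at 0 (depths (negations k k≤n)) m ≤ 1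
  negations-depth zero    _   m = subst (_≤ 1) (sym (inputs-depth n ≤-refl m)) z≤n
  negations-depth (suc k) k<n =
    at-∷ʳ-all (_≤ 1) 0 ds _ (negations-depth k (<⇒≤ k<n)) negated-input-depth z≤n
    where
    ds = depths (negations k (<⇒≤ k<n))
    i = fromℕ< (≤-trans k<n (m≤n+m n k))
    negated-input-depth : suc (lookup ds i) ≤ 1
    negated-input-depth = s≤s (≤-reflexive (begin
      lookup ds i          ≡⟨ lookup-at 0 ds i ⟩
      at 0 ds (toℕ i)      ≡⟨ cong (at 0 ds) (toℕ-fromℕ< _) ⟩
      at 0 ds k            ≡⟨ negations-input-depth k (<⇒≤ k<n) k<n ⟩
      0                    ∎))
      where open ≡-Reasoning

  literalGates-depth : ∀ m → at 0 (depths literalGates) m ≤ 1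
  literalGates-depth =
    at-∷ʳ-all (_≤ 1) 0 (depths (negations n ≤-refl) ∷ʳ 1) 1
      (at-∷ʳ-all (_≤ 1) 0 (depths (negations n ≤-refl)) 1 (negations-depth n ≤-refl) ≤-refl z≤n)
      ≤-refl z≤n

  query-depth : ∀ ls → depth (query ls) ≤ 2
  query-depth ls = subst (_≤ 2) (sym (last-∷ʳ _ (depths literalGates)))
    (s≤s (max-lookup-≤ (depths literalGates)
           (λ i → subst (_≤ 1) (sym (lookup-at 0 (depths literalGates) i)) (literalGates-depth (toℕ i)))
           (queried ls)))

  -- 2n + 3 gates, well within the cubic bound 3n³ + 3.
  query-size : ∀ ls → size (query ls) ≤ 3 * n ^ 3 + 3
  query-size ls = subst (3 + (n + n) ≤_) (+-comm 3 (3 * n ^ 3)) (+-monoʳ-≤ 3 (+-mono-≤ (n≤n³ n) n≤2n³))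
    where
    n≤2n³ : n ≤ n ^ 3 + (n ^ 3 + 0)
    n≤2n³ = ≤-trans (n≤n³ n) (m≤m+n (n ^ 3) (n ^ 3 + 0))

projection-reduction : ∀ {L L' : Language} (f : ℕ → List Literal) →
  (∀ xs → L xs ⇔ L' (map (eval xs) (f (length xs)))) → L ≤AC⁰ L'
projection-reduction {L} {L'} f correct =
  (λ n → query n (f n)) , 3 , 2 ,
  (λ n → LiteralCircuit.query-size n (f n)) , (λ n → LiteralCircuit.query-depth n (f n)) , decides
  where
  open LiteralCircuit using (query; module Values)
  decides : ∀ O → Decides O L' → ∀ n (x : Vec Bool n) → (output O (query n (f n)) x ≡ true) ⇔ L (toList x)
  decides O O-decides n x = mk⇔
    (λ out → Equivalence.from correct-x (Equivalence.to (O-decides w) (trans (sym output≡) out)))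
    (λ Lx → trans output≡ (Equivalence.from (O-decides w) (Equivalence.to correct-x Lx)))
    where
    w = map (eval (toList x)) (f n)
    output≡ : output O (query n (f n)) x ≡ O w
    output≡ = Values.query-output n O x (f n)
    correct-x : L (toList x) ⇔ L' w
    correct-x = subst (λ m → L (toList x) ⇔ L' (map (eval (toList x)) (f m))) (length-toList x) (correct (toList x))

-- The parity graph of an input x of length n is drawn in one column of
-- 2n+1 rows: rows 0, 2, …, 2n are always vertices and row 2j+1 is a vertex
-- exactly when x_j = 0.  Edges join consecutive vertex rows: 2j–2j+1 and
-- 2j+1–2j+2 when x_j = 0, and 2j–2j+2 when x_j = 1.  So it is a path, on
-- 2n+1 − (number of 1's of x) vertices.

height : ℕ → ℕ
height zero    = 1
height (suc n) = suc (suc (height n))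

-- Whether row r is a vertex, and whether rows a and c are joined by an
-- edge, each as a literal; rows 2j+2 and above look like those of the input
-- with x_j removed, shifted two rows up.
vertexLit : ℕ → Literal
vertexLit 0             = const true
vertexLit 1             = nvar 0
vertexLit (suc (suc r)) = shift (vertexLit r)

-- (The recursive clause comes first so that it computes for all a, c ≥ 2.)
edgeLit : ℕ → ℕ → Literal
edgeLit (suc (suc a)) (suc (suc c)) = shift (edgeLit a c)
edgeLit 0 1 = nvar 0
edgeLit 1 0 = nvar 0
edgeLit 1 2 = nvar 0
edgeLit 2 1 = nvar 0
edgeLit 0 2 = var 0
edgeLit 2 0 = var 0
edgeLit _ _ = const false

vertexRow : List Bool → ℕ → Bool
vertexRow xs r = eval xs (vertexLit r)

edgeRows : List Bool → ℕ → ℕ → Bool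
edgeRows xs a c = eval xs (edgeLit a c)

parityGraph : List Bool → LatticeGraph
parityGraph xs = columnGraph (height (length xs)) (vertexRow xs) (edgeRows xs)

edgeLit-sym : ∀ a c → edgeLit a c ≡ edgeLit c a
edgeLit-sym 0 0 = refl
edgeLit-sym 0 1 = refl
edgeLit-sym 0 2 = refl
edgeLit-sym 0 (suc (suc (suc c))) = refl
edgeLit-sym 1 0 = refl
edgeLit-sym 1 1 = refl
edgeLit-sym 1 2 = refl
edgeLit-sym 1 (suc (suc (suc c))) = refl
edgeLit-sym 2 0 = refl
edgeLit-sym 2 1 = refl
edgeLit-sym (suc (suc (suc a))) 0 = refl
edgeLit-sym (suc (suc (suc a))) 1 = refl
edgeLit-sym (suc (suc a)) (suc (suc c)) = cong shift (edgeLit-sym a c)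

edgeLit-irrefl : ∀ a → edgeLit a a ≡ const false
edgeLit-irrefl 0 = refl
edgeLit-irrefl 1 = refl
edgeLit-irrefl (suc (suc a)) = cong shift (edgeLit-irrefl a)

vertexRow-shift : ∀ b xs r → vertexRow (b ∷ xs) (suc (suc r)) ≡ vertexRow xs r
vertexRow-shift b xs r = eval-shift b xs (vertexLit r)

edgeRows-shift : ∀ b xs a c → edgeRows (b ∷ xs) (suc (suc a)) (suc (suc c)) ≡ edgeRows xs a c
edgeRows-shift b xs a c = eval-shift b xs (edgeLit a c)

consecutive-down : ∀ {b xs a c} → Consecutive (vertexRow (b ∷ xs)) (suc (suc a)) (suc (suc c)) →
                   Consecutive (vertexRow xs) a c
consecutive-down {b} {xs} {a} {c} ac = record
  { lower<upper = ≤-pred (≤-pred lower<upper)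
  ; lower = trans (sym (vertexRow-shift b xs a)) lower
  ; upper = trans (sym (vertexRow-shift b xs c)) upper
  ; gap = λ m a<m m<c → trans (sym (vertexRow-shift b xs m)) (gap (suc (suc m)) (s≤s (s≤s a<m)) (s≤s (s≤s m<c)))
  }
  where open Consecutive ac

consecutive-up : ∀ {b xs a c} → Consecutive (vertexRow xs) a c →
                 Consecutive (vertexRow (b ∷ xs)) (suc (suc a)) (suc (suc c))
consecutive-up {b} {xs} {a} {c} ac = record
  { lower<upper = s≤s (s≤s lower<upper)
  ; lower = trans (vertexRow-shift b xs a) lower
  ; upper = trans (vertexRow-shift b xs c) upper
  ; gap = gap-up
  }
  where
  open Consecutive ac
  gap-up : ∀ m → suc (suc a) < m → m < suc (suc c) → vertexRow (b ∷ xs) m ≡ false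
  gap-up (suc (suc m)) (s≤s (s≤s a<m)) (s≤s (s≤s m<c)) = trans (vertexRow-shift b xs m) (gap m a<m m<c)

edge-sound : ∀ xs a c → a < c → c < height (length xs) → edgeRows xs a c ≡ true →
             Consecutive (vertexRow xs) a c
edge-sound []       _ zero    () _ _
edge-sound []       _ (suc _) _  (s≤s ()) _
edge-sound (b ∷ xs) 0 1 _ _ e = record
  { lower<upper = s≤s z≤n ; lower = refl ; upper = e ; gap = λ { zero () _ ; (suc _) _ (s≤s ()) } }
edge-sound (b ∷ xs) 0 2 _ _ e = record
  { lower<upper = s≤s z≤n ; lower = refl ; upper = refl
  ; gap = λ { zero () _ ; 1 _ _ → cong not e ; (suc (suc _)) _ (s≤s (s≤s ())) } }
edge-sound (b ∷ xs) 1 2 _ _ e = record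
  { lower<upper = s≤s (s≤s z≤n) ; lower = e ; upper = refl
  ; gap = λ { zero () _ ; 1 (s≤s ()) _ ; (suc (suc _)) _ (s≤s (s≤s ())) } }
edge-sound (b ∷ xs) (suc (suc a)) (suc (suc c)) (s≤s (s≤s a<c)) (s≤s (s≤s c<h)) e =
  consecutive-up (edge-sound xs a c a<c c<h (trans (sym (edgeRows-shift b xs a c)) e))
edge-sound (b ∷ xs) 0 0 () _ _
edge-sound (b ∷ xs) 1 0 () _ _
edge-sound (b ∷ xs) 1 1 (s≤s ()) _ _
edge-sound (b ∷ xs) (suc (suc a)) 0 () _ _
edge-sound (b ∷ xs) (suc (suc a)) 1 (s≤s ()) _ _
edge-sound (b ∷ xs) 0 (suc (suc (suc c))) _ _ ()
edge-sound (b ∷ xs) 1 (suc (suc (suc c))) _ _ ()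

edge-complete : ∀ xs a c → Consecutive (vertexRow xs) a c → c < height (length xs) →
                edgeRows xs a c ≡ true
edge-complete []       _ zero    record { lower<upper = () } _
edge-complete []       _ (suc _) _ (s≤s ())
edge-complete (b ∷ xs) 0 1 ac _ = Consecutive.upper ac
edge-complete (true  ∷ xs) 0 2 ac _ = refl
edge-complete (false ∷ xs) 0 2 ac _ with Consecutive.gap ac 1 (s≤s z≤n) (s≤s (s≤s z≤n))
... | ()
edge-complete (b ∷ xs) 1 2 ac _ = Consecutive.lower ac
edge-complete (b ∷ xs) (suc (suc a)) (suc (suc c)) ac (s≤s (s≤s c<h)) =
  trans (edgeRows-shift b xs a c) (edge-complete xs a c (consecutive-down ac) c<h)
edge-complete (b ∷ xs) 0 0 record { lower<upper = () } _
edge-complete (b ∷ xs) 1 0 record { lower<upper = () } _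
edge-complete (b ∷ xs) 1 1 record { lower<upper = s≤s () } _
edge-complete (b ∷ xs) (suc (suc a)) 0 record { lower<upper = () } _
edge-complete (b ∷ xs) (suc (suc a)) 1 record { lower<upper = s≤s () } _
edge-complete (b ∷ xs) 0 (suc (suc (suc c))) ac _ with Consecutive.gap ac 2 (s≤s z≤n) (s≤s (s≤s (s≤s z≤n)))
... | ()
edge-complete (b ∷ xs) 1 (suc (suc (suc c))) ac _ with Consecutive.gap ac 2 (s≤s (s≤s z≤n)) (s≤s (s≤s (s≤s z≤n)))
... | ()

parity-joins : ∀ xs → JoinsConsecutive (height (length xs)) (vertexRow xs) (edgeRows xs)
parity-joins xs a c a< c< = mk⇔ to from
  where
  to : edgeRows xs a c ≡ true → Adjacent (vertexRow xs) a c
  to e with <-cmp a c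
  ... | tri< a<c _ _ = inj₁ (edge-sound xs a c a<c c< e)
  ... | tri> _ _ c<a = inj₂ (edge-sound xs c a c<a a< (trans (cong (eval xs) (edgeLit-sym c a)) e))
  ... | tri≈ _ refl _ with trans (sym (cong (eval xs) (edgeLit-irrefl a))) e
  ...   | ()
  from : Adjacent (vertexRow xs) a c → edgeRows xs a c ≡ true
  from (inj₁ ac) = edge-complete xs a c ac c<
  from (inj₂ ca) = trans (cong (eval xs) (edgeLit-sym a c)) (edge-complete xs c a ca a<)

-- Prepending a bit b adds two rows above the bottom row, of which row 1
-- is a vertex exactly when b = 0.
rank-cons : ∀ b xs r → rank (vertexRow (b ∷ xs)) (suc (suc r)) ≡
                       rank (vertexRow (b ∷ xs)) 2 + rank (vertexRow xs) r
rank-cons b xs zero = sym (+-identityʳ _)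
rank-cons b xs (suc r) = begin
  bit (vertexRow (b ∷ xs) (suc (suc r))) + rank (vertexRow (b ∷ xs)) (suc (suc r))
    ≡⟨ cong₂ (λ u w → bit u + w) (vertexRow-shift b xs r) (rank-cons b xs r) ⟩
  bit (vertexRow xs r) + (bottom + rank (vertexRow xs) r)
    ≡⟨ +-assoc (bit (vertexRow xs r)) bottom _ ⟨
  (bit (vertexRow xs r) + bottom) + rank (vertexRow xs) r
    ≡⟨ cong (_+ rank (vertexRow xs) r) (+-comm (bit (vertexRow xs r)) bottom) ⟩
  (bottom + bit (vertexRow xs r)) + rank (vertexRow xs) r
    ≡⟨ +-assoc bottom (bit (vertexRow xs r)) _ ⟩
  bottom + rank (vertexRow xs) (suc r)
    ∎
  where
  open ≡-Reasoning
  bottom = rank (vertexRow (b ∷ xs)) 2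

vertex-count : ∀ xs → rank (vertexRow xs) (height (length xs)) + ones xs ≡ suc (2 * length xs)
vertex-count [] = refl
vertex-count (true ∷ xs) = begin
  rank (vertexRow (true ∷ xs)) (height (length (true ∷ xs))) + suc (ones xs)
    ≡⟨ cong (_+ suc (ones xs)) (rank-cons true xs (height (length xs))) ⟩
  suc (rank (vertexRow xs) (height (length xs)) + suc (ones xs))
    ≡⟨ cong suc (+-suc _ (ones xs)) ⟩
  2 + (rank (vertexRow xs) (height (length xs)) + ones xs)
    ≡⟨ cong (2 +_) (vertex-count xs) ⟩
  2 + suc (2 * length xs)
    ≡⟨ cong suc (*-suc 2 (length xs)) ⟨
  suc (2 * length (true ∷ xs))
    ∎
  where open ≡-Reasoning
vertex-count (false ∷ xs) = begin
  rank (vertexRow (false ∷ xs)) (height (length (false ∷ xs))) + ones xs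
    ≡⟨ cong (_+ ones xs) (rank-cons false xs (height (length xs))) ⟩
  2 + (rank (vertexRow xs) (height (length xs)) + ones xs)
    ≡⟨ cong (2 +_) (vertex-count xs) ⟩
  2 + suc (2 * length xs)
    ≡⟨ cong suc (*-suc 2 (length xs)) ⟨
  suc (2 * length (false ∷ xs))
    ∎
  where open ≡-Reasoning

parity⇔BGGM : ∀ xs → Parity xs ⇔ BGGM (encode (parityGraph xs))
parity⇔BGGM xs = mk⇔ to from
  where
  open ColumnGraph (height (length xs)) (vertexRow xs) (edgeRows xs) (parity-joins xs)
  open PathFacts column-path
  matching⇔parity : HasPerfectMatching (parityGraph xs) ⇔ Parity xs
  matching⇔parity = even⇔odd-complement _ _ (length xs) (vertex-count xs) ⇔-∘ path-matching⇔even
  to : Parity xs → BGGM (encode (parityGraph xs))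
  to odd = parityGraph xs , refl , column-gridLayeredPlanar , path-bipartite ,
           Equivalence.from matching⇔parity odd
  from : BGGM (encode (parityGraph xs)) → Parity xs
  from (H , encH , _ , _ , H-matching) = Equivalence.to matching⇔parity
    (same-perfect-matching (encode-injective H (parityGraph xs) encH) H-matching)

parityGraphLiterals : ℕ → List Literal
parityGraphLiterals n =
  encodeLiterals 1 (height n) (λ p → vertexLit (row p)) (λ p q → edgeLit (row p) (row q))

theorem7 : Parity ≤AC⁰ BGGM
theorem7 = projection-reduction parityGraphLiterals λ xs →
  subst (λ w → Parity xs ⇔ BGGM w) (sym (encode-literalGraph xs 1 (height (length xs)) _ _)) (parity⇔BGGM xs)
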